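{- 1. $\lozenge$ is eliminable with respect to the class of all forward confluent frames; 2. $\square$ is eliminable with respect to the class of all downward confluent frames; 3. $⧫$ is eliminable with respect to the class of all forward confluent frames; 4. $\blacksquare$ is eliminable with respect to the class of all downward confluent frames.
   Context: Syntax. $\mathbf{At}=\{p_i : i\in\mathbb{N}\}$ is a countable set of atoms (enumerated without repetition). The set $\mathbf{Fo}$ of formulas is generated by $A ::= p \mid (A\rightharpoonup A)\mid (A\leftharpoondown A)\mid \top\mid\bot\mid (A\vee A)\mid (A\wedge A)\mid \lozenge A\mid\square A\mid⧫ A\mid\blacksquare A$, with $p\in\mathbf{At}$. Semantics. A frame is a triple $(W,\leq,R)$ where $W\neq\emptyset$, $\leq$ is a preorder (reflexive and transitive relation) on $W$ and $R$ is a binary relation on $W$; $\geq$ is the converse of $\leq$. A valuation is a function $V:\mathbf{At}\to\wp(W)$ such that each $V(p)$ is $\leq$-closed (if $s\in V(p)$ and $s\leq t$ then $t\in V(p)$). A model based on $(W,\leq,R)$ is $(W,\leq,R,V)$ with $V$ a valuation. Satisfaction at $s\in W$: $s\models p$ iff $s\in V(p)$; $s\models\top$; $s\not\models\bot$; $\vee,\wedge$ as usual pointwise; - $s\models A\rightharpoonup B$ iff for all $t\geq s$, $t\not\models A$ or $t\models B$; - $s\models A\leftharpoondown B$ iff there is $t\leq s$ with $t\not\models A$ and $t\models B$; - $s\models\lozenge A$ iff there are $t\leq s$ and $u$ with $tRu$ and $u\models A$; - $s\models\square A$ iff for all $t\geq s$ and all $u$, $tRu$ implies $u\models A$; - $s\models⧫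 A$ iff for all $t\geq s$ there is $u$ with $tRu$ and $u\models A$; - $s\models\blacksquare A$ iff there is $t\leq s$ such that for all $u$, $tRu$ implies $u\models A$. Composition: $s(R\circ S)t$ iff there is $u$ with $sRu$ and $uSt$. A frame is forward confluent if ${\geq}\circ R\subseteq R\circ{\geq}$, and downward confluent if ${\leq}\circ R\subseteq R\circ{\leq}$. A modal connective $\triangledown\in\{\lozenge,\square,⧫,\blacksquare\}$ is eliminable with respect to a class $\mathcal{C}$ of frames if for every atom $p$ there exists a formula $A$ containing no occurrence of $\triangledown$ such that for every frame in $\mathcal{C}$, every model based on it and every $s\in W$: $s\models\triangledown p$ iff $s\models A$. -}

module Defs where

open import Level using (Level; suc)
open import Data.Empty.Polymorphic using (⊥)
open import Data.Nat using (ℕ)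
open import Data.Product using (Σ-syntax; ∃-syntax; _×_)
open import Data.Sum using (_⊎_)
open import Data.Unit.Polymorphic using (⊤)
open import Function using (flip)
open import Function.Bundles using (_⇔_)
open import Relation.Binary.Construct.Composition using (_;_)
open import Relation.Binary.Core using (Rel; _⇒_)
open import Relation.Binary.PropositionalEquality using (_≡_)
open import Relation.Binary.Structures using (IsPreorder)
open import Relation.Nullary using (¬_)
open import Relation.Unary using (Pred)

-- The atom pᵢ is represented by its index i.
At : Set
At = ℕ

data Modality : Set where
  ◊ □ ⧫ ■ : Modality

infixr 20 _·_
infixr 15 _∧′_
infixr 14 _∨′_
infixr 13 _⇀_ _↽_

data Fo : Set where
  atom    : At → Fo
  _⇀_ _↽_ : Fo → Fo → Fo
  ⊤′ ⊥′   : Fo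
  _∨′_    : Fo → Fo → Fo
  _∧′_    : Fo → Fo → Fo
  _·_     : Modality → Fo → Fo

infix 4 _OccursIn_

data _OccursIn_ (▽ : Modality) : Fo → Set where
  here : ∀ {A}     → ▽ OccursIn ▽ · A
  mod  : ∀ {△ A}   → ▽ OccursIn A → ▽ OccursIn △ · A
  ⇀ˡ   : ∀ {A B}   → ▽ OccursIn A → ▽ OccursIn A ⇀ B
  ⇀ʳ   : ∀ {A B}   → ▽ OccursIn B → ▽ OccursIn A ⇀ B
  ↽ˡ   : ∀ {A B}   → ▽ OccursIn A → ▽ OccursIn A ↽ B
  ↽ʳ   : ∀ {A B}   → ▽ OccursIn B → ▽ OccursIn A ↽ B
  ∨ˡ   : ∀ {A B}   → ▽ OccursIn A → ▽ OccursIn A ∨′ B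
  ∨ʳ   : ∀ {A B}   → ▽ OccursIn B → ▽ OccursIn A ∨′ B
  ∧ˡ   : ∀ {A B}   → ▽ OccursIn A → ▽ OccursIn A ∧′ B
  ∧ʳ   : ∀ {A B}   → ▽ OccursIn B → ▽ OccursIn A ∧′ B

record Frame (ℓ : Level) : Set (suc ℓ) where
  infix 4 _≤_ _≥_
  field
    W          : Set ℓ
    inhabitant : W
    _≤_        : Rel W ℓ
    isPreorder : IsPreorder _≡_ _≤_
    R          : Rel W ℓ

  _≥_ : Rel W ℓ
  _≥_ = flip _≤_

record Valuation {ℓ} (F : Frame ℓ) : Set (suc ℓ) where
  open Frame F
  field
    V      : At → Pred W ℓ
    closed : ∀ p {s t} → V p s → s ≤ t → V p t

record Model (ℓ : Level) : Set (suc ℓ) where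
  constructor ⟨_,_⟩
  field
    frame     : Frame ℓ
    valuation : Valuation frame
  open Frame frame public
  open Valuation valuation public

infix 3 _∣_⊨_

-- The clauses for ⇀ and ↽ use the disjunctive form "t ⊭ A or t ⊨ B" and the
-- conjunctive form "t ⊭ A and t ⊨ B"; for ⇀ this is constructively stronger
-- than the function space.
_∣_⊨_ : ∀ {ℓ} (M : Model ℓ) → Model.W M → Fo → Set ℓ
M ∣ s ⊨ atom p = Model.V M p s
M ∣ s ⊨ A ⇀ B  = let open Model M in
                 ∀ t → t ≥ s → ¬ (M ∣ t ⊨ A) ⊎ (M ∣ t ⊨ B)
M ∣ s ⊨ A ↽ B  = let open Model M in
                 ∃[ t ] t ≤ s × ¬ (M ∣ t ⊨ A) × (M ∣ t ⊨ B)
M ∣ s ⊨ ⊤′     = ⊤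
M ∣ s ⊨ ⊥′     = ⊥
M ∣ s ⊨ A ∨′ B = (M ∣ s ⊨ A) ⊎ (M ∣ s ⊨ B)
M ∣ s ⊨ A ∧′ B = (M ∣ s ⊨ A) × (M ∣ s ⊨ B)
M ∣ s ⊨ ◊ · A  = let open Model M in
                 ∃[ t ] ∃[ u ] t ≤ s × R t u × (M ∣ u ⊨ A)
M ∣ s ⊨ □ · A  = let open Model M in
                 ∀ t → t ≥ s → ∀ u → R t u → M ∣ u ⊨ A
M ∣ s ⊨ ⧫ · A  = let open Model M in
                 ∀ t → t ≥ s → ∃[ u ] R t u × (M ∣ u ⊨ A)
M ∣ s ⊨ ■ · A  = let open Model M in
                 ∃[ t ] t ≤ s × (∀ u → R t u → M ∣ u ⊨ A)

-- The composition operator is U+037E (GREEK QUESTION MARK), not a semicolon.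
ForwardConfluent : ∀ {ℓ} → Pred (Frame ℓ) ℓ
ForwardConfluent F = (_≥_ ; R) ⇒ (R ; _≥_)
  where open Frame F

DownwardConfluent : ∀ {ℓ} → Pred (Frame ℓ) ℓ
DownwardConfluent F = (_≤_ ; R) ⇒ (R ; _≤_)
  where open Frame F

Eliminable : ∀ {ℓ c} → Modality → Pred (Frame ℓ) c → Set _
Eliminable ▽ C =
  ∀ (p : At) → Σ[ A ∈ Fo ] ¬ (▽ OccursIn A) ×
    (∀ F → C F → ∀ (V : Valuation F) (s : Frame.W F) →
      (⟨ F , V ⟩ ∣ s ⊨ ▽ · atom p) ⇔ (⟨ F , V ⟩ ∣ s ⊨ A))

{-# OPTIONS --safe #-}

-- Confluence makes "some R-successor satisfies A" (forward) and "every R-successor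
-- satisfies A" (downward) stable under moving up along ≤ when A is persistent, so
-- quantifying over t ≤ s or over t ≥ s makes no difference: ◊ and ⧫ coincide on
-- forward confluent frames, □ and ■ on downward confluent ones.
module Submission where

open import Level using (Level)
open import Data.Product using (_×_; _,_)
open import Function.Bundles using (_⇔_; mk⇔)
open import Function.Construct.Symmetry using (⇔-sym)
open import Relation.Binary.Structures using (IsPreorder)
open import Defs

private
  variable
    ℓ : Level

Persistent : Model ℓ → Fo → Set ℓ
Persistent M A = ∀ {s t} → M ∣ s ⊨ A → s ≤ t → M ∣ t ⊨ A
  where open Model M

-- Forward confluence carries a successor of some `t ≤ s` to a successor above it of any `t′ ≥ s`.
-- Conversely, reflexivity lets `s` be its own witness.
◊⇔⧫ : (M : Model ℓ) → ForwardConfluent (Model.frame M) →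
      ∀ {A} → Persistent M A → ∀ s → (M ∣ s ⊨ ◊ · A) ⇔ (M ∣ s ⊨ ⧫ · A)
◊⇔⧫ M confluent {A} persistent s = mk⇔ to from
  where
  open Model M
  open IsPreorder isPreorder using (refl; trans)

  to : M ∣ s ⊨ ◊ · A → M ∣ s ⊨ ⧫ · A
  to (t , u , t≤s , tRu , u⊨A) t′ s≤t′ =
    let v , t′Rv , u≤v = confluent (t , trans t≤s s≤t′ , tRu)
    in v , t′Rv , persistent u⊨A u≤v

  from : M ∣ s ⊨ ⧫ · A → M ∣ s ⊨ ◊ · A
  from s⊨⧫A = let u , sRu , u⊨A = s⊨⧫A s refl in s , u , refl , sRu , u⊨A

-- From right to left, each successor of `t′ ≥ s` lies above a successor of the witness `t ≤ s`, and
-- persistence moves truth up to it.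
□⇔■ : (M : Model ℓ) → DownwardConfluent (Model.frame M) →
      ∀ {A} → Persistent M A → ∀ s → (M ∣ s ⊨ □ · A) ⇔ (M ∣ s ⊨ ■ · A)
□⇔■ M confluent {A} persistent s = mk⇔ to from
  where
  open Model M
  open IsPreorder isPreorder using (refl; trans)

  to : M ∣ s ⊨ □ · A → M ∣ s ⊨ ■ · A
  to s⊨□A = s , refl , s⊨□A s refl

  from : M ∣ s ⊨ ■ · A → M ∣ s ⊨ □ · A
  from (t , t≤s , R[t]⊨A) t′ s≤t′ u t′Ru =
    let v , tRv , v≤u = confluent (t′ , trans t≤s s≤t′ , t′Ru)
    in persistent (R[t]⊨A v tRv) v≤u

proposition20 : (ℓ : Level) →
    Eliminable ◊ (ForwardConfluent {ℓ})
    × Eliminable □ (DownwardConfluent {ℓ})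
    × Eliminable ⧫ (ForwardConfluent {ℓ})
    × Eliminable ■ (DownwardConfluent {ℓ})
proposition20 ℓ =
    -- The outer modalities differ, so an occurrence would have to lie inside the atom.
    (λ p → ⧫ · atom p , (λ { (mod ()) }) ,
       λ F fc V s → ◊⇔⧫ ⟨ F , V ⟩ fc {atom p} (Valuation.closed V p) s)
  , (λ p → ■ · atom p , (λ { (mod ()) }) ,
       λ F dc V s → □⇔■ ⟨ F , V ⟩ dc {atom p} (Valuation.closed V p) s)
  , (λ p → ◊ · atom p , (λ { (mod ()) }) ,
       λ F fc V s → ⇔-sym (◊⇔⧫ ⟨ F , V ⟩ fc {atom p} (Valuation.closed V p) s))
  , (λ p → □ · atom p , (λ { (mod ()) }) ,
       λ F dc V s → ⇔-sym (□⇔■ ⟨ F , V ⟩ dc {atom p} (Valuation.closed V p) s))
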